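{- If $G$ is a co-comparability graph, then $\mathrm{cub}(G)\le 2\Delta$, where $\Delta$ is the maximum degree of $G$ and $\mathrm{cub}(G)$ denotes the cubicity of $G$.
   Context: All graphs are simple, finite and undirected. Cubicity: a $k$-cube is a Cartesian product $R_1\times\cdots\times R_k$ where each $R_i$ is a closed interval of the form $[a_i,a_i+1]$ on the real line. The cubicity $\mathrm{cub}(G)$ is the minimum $k$ such that each vertex of $G$ can be mapped to a $k$-cube so that two distinct vertices are adjacent in $G$ if and only if their $k$-cubes have non-empty intersection. A graph $G$ is a co-comparability graph if its complement $\overline{G}$ is a comparability graph, i.e. there is a (strict) partial order $\prec$ on $V(G)$ such that distinct vertices $u,v$ are adjacent in $\overline{G}$ if and only if $u\prec v$ or $v\prec u$.
   Formalization: Graphs with at least two vertices are assumed to have an edge (Δ ≥ 1), since an edgeless graph on two or more vertices is a co-comparability graph with Δ = 0 but cubicity 1, so the bound as stated fails there. -}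

module Defs where

open import Data.Empty using (⊥)
open import Data.Fin using (Fin; _≟_)
open import Data.List using (length; filter; map; allFin)
open import Data.List.Extrema.Nat using (max)
open import Data.Nat as ℕ using (ℕ)
open import Data.Product using (_×_; _,_; Σ-syntax; ∃-syntax; proj₁; proj₂)
open import Data.Rational using (ℚ; 1ℚ; _+_; _-_; -_; _<_)
open import Data.Rational.Properties
  using (+-assoc; +-identityʳ; +-inverseˡ; +-inverseʳ; +-monoˡ-<)
open import Data.Sum using (_⊎_)
open import Function using (_∘_)
open import Function.Bundles using (_⇔_)
open import Level using (0ℓ)
open import Relation.Binary using (Rel; Decidable; Symmetric; Irreflexive; IsStrictPartialOrder)
open import Relation.Binary.PropositionalEquality using (_≡_; _≢_; sym; trans; cong; subst)
open import Relation.Nullary using (¬_; ¬?; _×-dec_)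

-- Two-sided located Dedekind cuts; the setoid equality is x ≤ᴿ y × y ≤ᴿ x.
record ℝ : Set₁ where
  field
    L U       : ℚ → Set
    inhabited : (∃[ q ] L q) × (∃[ r ] U r)
    L-lower   : ∀ {q r} → q < r → L r → L q
    L-open    : ∀ {q} → L q → ∃[ r ] (q < r × L r)
    U-upper   : ∀ {q r} → q < r → U q → U r
    U-open    : ∀ {r} → U r → ∃[ q ] (q < r × U q)
    disjoint  : ∀ {q} → L q → U q → ⊥
    located   : ∀ {q r} → q < r → L q ⊎ U r

open ℝ public using (L; U)

infix 4 _≤ᴿ_

_≤ᴿ_ : ℝ → ℝ → Set
x ≤ᴿ y = ∀ {q} → L x q → L y q

private
  p+1-1≡p : ∀ p → (p + 1ℚ) - 1ℚ ≡ p
  p+1-1≡p p = trans (+-assoc p 1ℚ (- 1ℚ))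
                (trans (cong (p +_) (+-inverseʳ 1ℚ)) (+-identityʳ p))

  p-1+1≡p : ∀ p → (p - 1ℚ) + 1ℚ ≡ p
  p-1+1≡p p = trans (+-assoc p (- 1ℚ) 1ℚ)
                (trans (cong (p +_) (+-inverseˡ 1ℚ)) (+-identityʳ p))

  -1-mono : ∀ {q r} → q < r → q - 1ℚ < r - 1ℚ
  -1-mono = +-monoˡ-< (- 1ℚ)

  +1-mono : ∀ {q r} → q < r → q + 1ℚ < r + 1ℚ
  +1-mono = +-monoˡ-< 1ℚ

infix 6 _+1

_+1 : ℝ → ℝ
x +1 = record
  { L         = λ q → L x (q - 1ℚ)
  ; U         = λ q → U x (q - 1ℚ)
  ; inhabited = (let (q , l) = proj₁ inhabited in q + 1ℚ , up (L x) l)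
              , (let (r , u) = proj₂ inhabited in r + 1ℚ , up (U x) u)
  ; L-lower   = L-lower ∘ -1-mono
  ; L-open    = λ {q} l → let (r , q<r , l′) = L-open l in
                  r + 1ℚ , subst (_< r + 1ℚ) (p-1+1≡p q) (+1-mono q<r) , up (L x) l′
  ; U-upper   = U-upper ∘ -1-mono
  ; U-open    = λ {r} u → let (q , q<r , u′) = U-open u in
                  q + 1ℚ , subst (q + 1ℚ <_) (p-1+1≡p r) (+1-mono q<r) , up (U x) u′
  ; disjoint  = disjoint
  ; located   = located ∘ -1-mono
  }
  where
  open ℝ x hiding (L; U)

  up : (P : ℚ → Set) → ∀ {p} → P p → P ((p + 1ℚ) - 1ℚ)
  up P {p} = subst P (sym (p+1-1≡p p))

record Graph (n : ℕ) : Set₁ where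
  field
    Adj    : Rel (Fin n) 0ℓ
    adj?   : Decidable Adj
    symm   : Symmetric Adj
    irrefl : Irreflexive _≡_ Adj

open Graph public

complement : ∀ {n} → Graph n → Graph n
complement G = record
  { Adj    = λ u v → u ≢ v × ¬ Adj G u v
  ; adj?   = λ u v → ¬? (u ≟ v) ×-dec ¬? (adj? G u v)
  ; symm   = λ (u≢v , ¬uv) → (u≢v ∘ sym) , (¬uv ∘ symm G)
  ; irrefl = λ u≡v (u≢v , _) → u≢v u≡v
  }

degree : ∀ {n} → Graph n → Fin n → ℕ
degree {n} G v = length (filter (adj? G v) (allFin n))

-- 0 for the graph with no vertices.
maxDegree : ∀ {n} → Graph n → ℕ
maxDegree {n} G = max 0 (map (degree G) (allFin n))

IsComparability : ∀ {n} → Graph n → Set₁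
IsComparability {n} G =
  Σ[ _≺_ ∈ Rel (Fin n) 0ℓ ]
    (IsStrictPartialOrder _≡_ _≺_ × (∀ u v → u ≢ v → Adj G u v ⇔ (u ≺ v ⊎ v ≺ u)))

IsCoComparability : ∀ {n} → Graph n → Set₁
IsCoComparability G = IsComparability (complement G)

-- The k-cube [a₁ , a₁ + 1] × ⋯ × [aₖ , aₖ + 1] is given by its corner a.
Cube : ℕ → Set₁
Cube k = Fin k → ℝ

_∈ᶜ_ : ∀ {k} → (Fin k → ℝ) → Cube k → Set
x ∈ᶜ a = ∀ i → a i ≤ᴿ x i × x i ≤ᴿ a i +1

Intersect : ∀ {k} → Cube k → Cube k → Set₁
Intersect a b = ∃[ x ] (x ∈ᶜ a × x ∈ᶜ b)

CubeRepresentation : ∀ {n} → Graph n → ℕ → Set₁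
CubeRepresentation {n} G k =
  Σ[ cube ∈ (Fin n → Cube k) ]
    (∀ u v → u ≢ v → Adj G u v ⇔ Intersect (cube u) (cube v))

IsCubicity : ∀ {n} → Graph n → ℕ → Set₁
IsCubicity G c = CubeRepresentation G c × (∀ k → CubeRepresentation G k → c ℕ.≤ k)

-- cub(G) ≤ m.  Having a least element is not constructively automatic for an
-- inhabited set of naturals, so the second component alone could hold for want
-- of a cubicity; the first provides a representation in dimension at most m.
Cubicity≤ : ∀ {n} → Graph n → ℕ → Set₁
Cubicity≤ G m =
  (∃[ k ] (k ℕ.≤ m × CubeRepresentation G k)) × (∀ c → IsCubicity G c → c ℕ.≤ m)

{-# OPTIONS --safe #-}
module Submission where

-- Order the vertices by a linear extension of ≺.  If u < v are adjacent in G,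
-- then no w strictly between them has u ≺ w ≺ v, so N(u) ∪ N(v) contains the
-- whole interval from u to v; hence the ordering has width b ≤ 2Δ − 1.
-- An ordering of width b yields a cube representation in dimension b + 1.  For
-- each residue class modulo b one coordinate separates every vertex i of the
-- class from its non-neighbours in {i+1, …, i+b−1}; one further coordinate, a
-- perturbation of the ordering itself, separates the non-adjacent pairs at
-- distance at least b.

open import Defs
open import Data.Nat using (ℕ; _≤_; _*_)

open import Algebra.Properties.Group using (//-rightDividesʳ)
open import Data.Fin as Fin using (Fin; zero; suc; toℕ; fromℕ<)
open import Data.Fin.Properties using (any?; toℕ-fromℕ<; toℕ<n; toℕ-injective)
import Data.Integer as ℤ
import Data.Integer.Properties as ℤ
open import Data.List using ([]; _∷_; length; filter; map; allFin)
open import Data.List.Extrema.Nat using (xs≤max)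
open import Data.List.Membership.Propositional using (_∈_)
open import Data.List.Membership.Propositional.Properties using (∈-allFin)
open import Data.List.Properties using (length-filter; length-tabulate)
import Data.List.Relation.Unary.All as All
import Data.List.Relation.Unary.All.Properties as All
open import Data.List.Relation.Unary.Any using (here; there)
open import Data.Nat
  using (zero; suc; _+_; _∸_; _⊔_; _<_; z≤n; s≤s; z<s; NonZero; _≟_; _≤?_; _<?_)
open import Data.Nat.Divisibility using (n∣n)
open import Data.Nat.DivMod
open import Data.Nat.Properties
open import Data.Product using (_×_; _,_; ∃-syntax; proj₁; proj₂)
import Data.Rational as ℚ
open ℚ using (ℚ; 1ℚ)
import Data.Rational.Properties as ℚ
open import Data.Rational.Unnormalised as ℚᵘ using (mkℚᵘ; 1ℚᵘ)
import Data.Rational.Unnormalised.Properties as ℚᵘ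
open import Data.Sum using (_⊎_; inj₁; inj₂; [_,_]′)
open import Function using (_∘_; _⇔_; mk⇔)
open import Function.Bundles using (module Equivalence)
open import Level using (0ℓ)
open import Relation.Binary using (Rel; Decidable; IsStrictPartialOrder; tri<; tri≈; tri>)
open import Relation.Binary.PropositionalEquality
open import Relation.Nullary using (¬_; Dec; yes; no; contradiction; _×-dec_; _⊎-dec_)
open import Relation.Nullary.Decidable using (decidable-stable)
import Relation.Unary as Unary

-- Rational numbers as Dedekind cuts.

fromℚ : ℚ → ℝ
fromℚ p = record
  { L         = ℚ._< p
  ; U         = p ℚ.<_
  ; inhabited = (p ℚ.- 1ℚ , ℚ.<-respʳ-≡ (ℚ.+-identityʳ p) (ℚ.+-monoʳ-< p (ℚ.negative⁻¹ (ℚ.- 1ℚ))))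
              , (p ℚ.+ 1ℚ , ℚ.<-respˡ-≡ (ℚ.+-identityʳ p) (ℚ.+-monoʳ-< p (ℚ.positive⁻¹ 1ℚ)))
  ; L-lower   = ℚ.<-trans
  ; L-open    = λ l → let (m , q<m , m<p) = ℚ.<-dense l in m , q<m , m<p
  ; U-upper   = λ q<r p<q → ℚ.<-trans p<q q<r
  ; U-open    = λ u → let (m , p<m , m<r) = ℚ.<-dense u in m , m<r , p<m
  ; disjoint  = λ q<p p<q → ℚ.<-asym q<p p<q
  ; located   = λ {q} {r} q<r → locate q<r (q ℚ.<? p)
  }
  where
  locate : ∀ {q r} → q ℚ.< r → Dec (q ℚ.< p) → q ℚ.< p ⊎ p ℚ.< r
  locate q<r (yes q<p) = inj₁ q<p
  locate q<r (no q≮p)  = inj₂ (ℚ.≤-<-trans (ℚ.≮⇒≥ q≮p) q<r)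

fromℚ-mono : ∀ {p q} → p ℚ.≤ q → fromℚ p ≤ᴿ fromℚ q
fromℚ-mono p≤q r<p = ℚ.<-≤-trans r<p p≤q

p+1-1≡p : ∀ p → (p ℚ.+ 1ℚ) ℚ.- 1ℚ ≡ p
p+1-1≡p = //-rightDividesʳ ℚ.+-0-group 1ℚ

fromℚ-≤-+1 : ∀ {p q} → p ℚ.≤ q ℚ.+ 1ℚ → fromℚ p ≤ᴿ fromℚ q +1
fromℚ-≤-+1 {p} {q} p≤q+1 {r} r<p =
  subst (r ℚ.- 1ℚ ℚ.<_) (p+1-1≡p q) (ℚ.+-monoˡ-< (ℚ.- 1ℚ) (ℚ.<-≤-trans r<p p≤q+1))

-- If `q + 1 < p`, then `q + 1` itself lies in the lower cut of `p`, and the hypothesis puts it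
-- below the shifted cut, that is, `q < q`.
fromℚ-≤-+1⁻¹ : ∀ {p q} → fromℚ p ≤ᴿ fromℚ q +1 → p ℚ.≤ q ℚ.+ 1ℚ
fromℚ-≤-+1⁻¹ {p} {q} p≤q+1 = ℚ.≮⇒≥ λ q+1<p → ℚ.<-irrefl (p+1-1≡p q) (p≤q+1 q+1<p)

-- From natural-number coordinates to cubes.

infix 7 _÷suc_

_÷suc_ : ℕ → ℕ → ℚ
p ÷suc c = ℚ.fromℚᵘ (mkℚᵘ (ℤ.+ p) c)

÷suc-mono-≤ : ∀ c {p q} → p ≤ q → p ÷suc c ℚ.≤ q ÷suc c
÷suc-mono-≤ c {p} {q} p≤q = ℚ.toℚᵘ-cancel-≤
  (ℚᵘ.≤-respˡ-≃ (ℚᵘ.≃-sym (ℚ.toℚᵘ-fromℚᵘ (mkℚᵘ (ℤ.+ p) c)))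
    (ℚᵘ.≤-respʳ-≃ (ℚᵘ.≃-sym (ℚ.toℚᵘ-fromℚᵘ (mkℚᵘ (ℤ.+ q) c)))
      (ℚᵘ.*≤* (ℤ.*-monoʳ-≤-nonNeg (ℤ.+ suc c) (ℤ.+≤+ p≤q)))))

÷suc-mono-< : ∀ c {p q} → p < q → p ÷suc c ℚ.< q ÷suc c
÷suc-mono-< c {p} {q} p<q = ℚ.toℚᵘ-cancel-<
  (ℚᵘ.<-respˡ-≃ (ℚᵘ.≃-sym (ℚ.toℚᵘ-fromℚᵘ (mkℚᵘ (ℤ.+ p) c)))
    (ℚᵘ.<-respʳ-≃ (ℚᵘ.≃-sym (ℚ.toℚᵘ-fromℚᵘ (mkℚᵘ (ℤ.+ q) c)))
      (ℚᵘ.*<* (ℤ.*-monoʳ-<-pos (ℤ.+ suc c) (ℤ.+<+ p<q)))))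

÷suc-+1 : ∀ p c → (p + suc c) ÷suc c ≡ p ÷suc c ℚ.+ 1ℚ
÷suc-+1 p c = ℚ.toℚᵘ-injective (begin
  ℚ.toℚᵘ ((p + suc c) ÷suc c)    ≈⟨ ℚ.toℚᵘ-fromℚᵘ (mkℚᵘ (ℤ.+ (p + suc c)) c) ⟩
  mkℚᵘ (ℤ.+ (p + suc c)) c       ≈⟨ ℚᵘ.*≡* (cong₂ ℤ._*_ numerator denominator) ⟩
  mkℚᵘ (ℤ.+ p) c ℚᵘ.+ 1ℚᵘ        ≈⟨ ℚᵘ.+-congˡ 1ℚᵘ (ℚ.toℚᵘ-fromℚᵘ (mkℚᵘ (ℤ.+ p) c)) ⟨
  ℚ.toℚᵘ (p ÷suc c) ℚᵘ.+ 1ℚᵘ     ≈⟨ ℚ.toℚᵘ-homo-+ (p ÷suc c) 1ℚ ⟨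
  ℚ.toℚᵘ (p ÷suc c ℚ.+ 1ℚ)     ∎)
  where
  open ℚᵘ.≃-Reasoning
  numerator : ℤ.+ (p + suc c) ≡ (ℤ.+ p) ℤ.* (ℤ.+ 1) ℤ.+ (ℤ.+ 1) ℤ.* (ℤ.+ suc c)
  numerator = sym (cong₂ ℤ._+_ (ℤ.*-identityʳ (ℤ.+ p)) (ℤ.*-identityˡ (ℤ.+ suc c)))
  denominator : ℤ.+ (suc c * 1) ≡ ℤ.+ suc c
  denominator = cong ℤ.+_ (*-identityʳ (suc c))

-- Scaling coordinate `i` by `suc (c i)` turns unit intervals into intervals with natural endpoints,
-- so the geometry reduces to arithmetic in ℕ. A one-sided closeness bound is enough because
-- adjacency is symmetric.
cubeRepresentation :
  ∀ {n} (G : Graph n) k (c : Fin k → ℕ) (p : Fin k → Fin n → ℕ) →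
  (∀ {u v} → Adj G u v → ∀ i → p i u ≤ p i v + suc (c i)) →
  (∀ {u v} → u ≢ v → ¬ Adj G u v →
    ∃[ i ] (p i u + suc (c i) < p i v ⊎ p i v + suc (c i) < p i u)) →
  CubeRepresentation G k
cubeRepresentation {n} G k c p close apart = cube , λ u v u≢v → mk⇔ (meet u v) (adjacent u v u≢v)
  where
  corner : Fin n → Fin k → ℚ
  corner v i = p i v ÷suc c i

  cube : Fin n → Cube k
  cube v i = fromℚ (corner v i)

  within : ∀ v i {m} → p i v ≤ m → m ≤ p i v + suc (c i) →
           cube v i ≤ᴿ fromℚ (m ÷suc c i) × fromℚ (m ÷suc c i) ≤ᴿ cube v i +1
  within v i {m} lo hi =
      fromℚ-mono (÷suc-mono-≤ (c i) lo)
    , fromℚ-≤-+1 (subst (m ÷suc c i ℚ.≤_) (÷suc-+1 (p i v) (c i)) (÷suc-mono-≤ (c i) hi))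

  meet : ∀ u v → Adj G u v → Intersect (cube u) (cube v)
  meet u v uv =
      -- Of two overlapping intervals of equal length, the larger left end lies in both.
      (λ i → fromℚ ((p i u ⊔ p i v) ÷suc c i))
    , (λ i → within u i (m≤m⊔n (p i u) (p i v))
                        (⊔-lub (m≤m+n (p i u) _) (close (symm G uv) i)))
    , (λ i → within v i (m≤n⊔m (p i u) (p i v))
                        (⊔-lub (close uv i) (m≤m+n (p i v) _)))

  corners-close : ∀ {u v} → Intersect (cube u) (cube v) → ∀ i → corner u i ℚ.≤ corner v i ℚ.+ 1ℚ
  corners-close {u} {v} (x , x∈u , x∈v) i = fromℚ-≤-+1⁻¹ {corner u i} {corner v i}
    λ l → proj₂ (x∈v i) (proj₁ (x∈u i) l)

  not-apart : ∀ {u v} → Intersect (cube u) (cube v) → ∀ i → ¬ (p i v + suc (c i) < p i u)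
  not-apart {u} {v} meets i gap = ℚ.<-irrefl refl (ℚ.<-≤-trans
    (subst (ℚ._< corner u i) (÷suc-+1 (p i v) (c i)) (÷suc-mono-< (c i) gap))
    (corners-close meets i))

  adjacent : ∀ u v → u ≢ v → Intersect (cube u) (cube v) → Adj G u v
  -- Meeting cubes only refute non-adjacency; decidability of `Adj` turns this into an edge.
  adjacent u v u≢v meets@(x , x∈u , x∈v) = decidable-stable (adj? G u v) λ ¬uv →
    let (i , gap) = apart u≢v ¬uv
    in [ not-apart (x , x∈v , x∈u) i , not-apart meets i ]′ gap

-- Arithmetic of offsets within blocks, and residues.

label : ∀ {A : Set} → ℕ → Dec A → ℕ
label zero    _       = 0
label (suc _) (yes _) = 2
label (suc _) (no _)  = 3

label≤3 : ∀ {A : Set} o (d : Dec A) → label o d ≤ 3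
label≤3 zero    _       = z≤n
label≤3 (suc _) (yes _) = s≤s (s≤s z≤n)
label≤3 (suc _) (no _)  = ≤-refl

2≤label : ∀ {A : Set} o (d : Dec A) → 2 ≤ label (suc o) d
2≤label _ (yes _) = ≤-refl
2≤label _ (no _)  = s≤s (s≤s z≤n)

label≡2 : ∀ {A : Set} o (d : Dec A) → A → label (suc o) d ≡ 2
label≡2 _ (yes _) _ = refl
label≡2 _ (no ¬a) a = contradiction a ¬a

label≡3 : ∀ {A : Set} o (d : Dec A) → ¬ A → label (suc o) d ≡ 3
label≡3 _ (yes a) ¬a = contradiction a ¬a
label≡3 _ (no _)  _  = refl

-- Meant for indices `i < j` in blocks `t`, `t′` at offsets `o`, `o′`. The only danger is `o′ ≡ 0`,
-- where the label drops to 0; there a new block has begun, and the larger block number makes up for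
-- it.
label-up : ∀ {A B : Set} t o t′ o′ (d : Dec A) (d′ : Dec B) →
  t ≤ t′ → (o′ ≡ 0 → t < t′) → t + label o d ≤ t′ + label o′ d′ + 2
label-up t o t′ zero d d′ _ t<t′ = begin
  t + label o d  ≤⟨ +-monoʳ-≤ t (label≤3 o d) ⟩
  t + 3          ≡⟨ +-suc t 2 ⟩
  suc t + 2      ≤⟨ +-monoˡ-≤ 2 (t<t′ refl) ⟩
  t′ + 2         ≡⟨ cong (_+ 2) (+-identityʳ t′) ⟨
  t′ + 0 + 2     ∎
  where open ≤-Reasoning
label-up t o t′ (suc o′) d d′ t≤t′ _ = begin
  t + label o d                ≤⟨ +-mono-≤ t≤t′ (label≤3 o d) ⟩
  t′ + 3                       ≤⟨ +-monoʳ-≤ t′ (n≤1+n 3) ⟩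
  t′ + (2 + 2)                 ≤⟨ +-monoʳ-≤ t′ (+-monoˡ-≤ 2 (2≤label o′ d′)) ⟩
  t′ + (label (suc o′) d′ + 2) ≡⟨ +-assoc t′ _ 2 ⟨
  t′ + label (suc o′) d′ + 2   ∎
  where open ≤-Reasoning

-- An offset `o ≢ 0` already contributes 2, enough to absorb one block step and the label 3. For
-- `o ≡ 0` and `o′ ≢ 0` the bound is tight: the block must be the same and the label exactly 2.
label-down : ∀ {A B : Set} t o t′ o′ (d : Dec A) (d′ : Dec B) →
  t′ ≤ suc t → (o ≡ 0 → o′ ≢ 0 → t′ ≤ t × B) → t′ + label o′ d′ ≤ t + label o d + 2
label-down t (suc o) t′ o′ d d′ t′≤1+t _ = begin
  t′ + label o′ d′           ≤⟨ +-mono-≤ t′≤1+t (label≤3 o′ d′) ⟩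
  suc t + 3                  ≡⟨ +-suc t 3 ⟨
  t + (2 + 2)                ≤⟨ +-monoʳ-≤ t (+-monoˡ-≤ 2 (2≤label o d)) ⟩
  t + (label (suc o) d + 2)  ≡⟨ +-assoc t _ 2 ⟨
  t + label (suc o) d + 2    ∎
  where open ≤-Reasoning
label-down t zero t′ zero d d′ t′≤1+t _ = begin
  t′ + 0     ≡⟨ +-identityʳ t′ ⟩
  t′         ≤⟨ t′≤1+t ⟩
  1 + t      ≤⟨ n≤1+n (1 + t) ⟩
  2 + t      ≡⟨ +-comm 2 t ⟩
  t + 2      ≡⟨ cong (_+ 2) (+-identityʳ t) ⟨
  t + 0 + 2  ∎
  where open ≤-Reasoning
label-down t zero t′ (suc o′) d d′ _ near = begin
  t′ + label (suc o′) d′  ≡⟨ cong (t′ +_) (label≡2 o′ d′ (proj₂ (near refl λ ()))) ⟩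
  t′ + 2                  ≤⟨ +-monoˡ-≤ 2 (proj₁ (near refl λ ())) ⟩
  t + 2                   ≡⟨ cong (_+ 2) (+-identityʳ t) ⟨
  t + 0 + 2               ∎
  where open ≤-Reasoning

bit : ∀ {A : Set} → Dec A → ℕ
bit (yes _) = 0
bit (no _)  = 1

bit≤1 : ∀ {A : Set} (d : Dec A) → bit d ≤ 1
bit≤1 (yes _) = z≤n
bit≤1 (no _)  = ≤-refl

bit≡0 : ∀ {A : Set} (d : Dec A) → A → bit d ≡ 0
bit≡0 (yes _) _ = refl
bit≡0 (no ¬a) a = contradiction a ¬a

bit≡1 : ∀ {A : Set} (d : Dec A) → ¬ A → bit d ≡ 1
bit≡1 (yes a) ¬a = contradiction a ¬a
bit≡1 (no _)  _  = refl

-- As `b′` is congruent to -1 modulo `suc b′`, this residue is that of `-i`. It selects the `star`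
-- coordinate in whose class `i` lies.
complementary-residue : ∀ i b′ → (i + (b′ * i) % suc b′) % suc b′ ≡ 0
complementary-residue i b′ = begin
  (i + (b′ * i) % b) % b          ≡⟨ %-distribˡ-+ i ((b′ * i) % b) b ⟩
  (i % b + (b′ * i) % b % b) % b  ≡⟨ cong (λ x → (i % b + x) % b) (m%n%n≡m%n (b′ * i) b) ⟩
  (i % b + (b′ * i) % b) % b      ≡⟨ %-distribˡ-+ i (b′ * i) b ⟨
  (b * i) % b                     ≡⟨ cong (_% b) (*-comm b i) ⟩
  (i * b) % b                     ≡⟨ m*n%n≡0 i b ⟩
  0                               ∎
  where
  open ≡-Reasoning
  b = suc b′

[m+n]/n≡1+m/n : ∀ m n .{{_ : NonZero n}} → (m + n) / n ≡ suc (m / n)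
[m+n]/n≡1+m/n m n = begin
  (m + n) / n    ≡⟨ +-distrib-/-∣ʳ m n∣n ⟩
  m / n + n / n  ≡⟨ cong (m / n +_) (n/n≡1 n) ⟩
  m / n + 1      ≡⟨ +-comm _ 1 ⟩
  suc (m / n)    ∎
  where open ≡-Reasoning

-- Coordinates for an ordering of bounded width.

module Bandwidth
  {E : Rel ℕ 0ℓ} (E? : Decidable E) (b : ℕ) .{{_ : NonZero b}}
  (width : ∀ {i j} → E i j → j ≤ i + b)
  where

  -- The coordinate (with unit 2) of the class i ≡ −r (mod b).  The members of
  -- the class cut the ordering into blocks; the block of the member i starts at
  -- position t = (i + r) / b with i itself, its neighbours sit at t + 2, and all
  -- others at t + 3.  In a block without a member of the class (the first one,
  -- where ∸ truncates) the choice between t + 2 and t + 3 is irrelevant.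
  star : ℕ → ℕ → ℕ
  star r i = (i + r) / b + label ((i + r) % b) (E? (i ∸ (i + r) % b) i)

  star-up : ∀ r {i j} → i < j → star r i ≤ star r j + 2
  star-up r {i} {j} i<j = label-up t _ t′ o′ _ _ (/-monoˡ-≤ b (<⇒≤ i+r<j+r)) λ o′≡0 →
    -- When `j + r` is a multiple of `b`, the smaller `i + r` lies in an earlier block.
    *-cancelʳ-< b t t′ (begin-strict
      t * b        ≤⟨ m/n*n≤m (i + r) b ⟩
      i + r        <⟨ i+r<j+r ⟩
      j + r        ≡⟨ m≡m%n+[m/n]*n (j + r) b ⟩
      o′ + t′ * b  ≡⟨ cong (_+ t′ * b) o′≡0 ⟩
      t′ * b       ∎)
    where
    open ≤-Reasoning
    t = (i + r) / b ; t′ = (j + r) / b ; o′ = (j + r) % b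
    i+r<j+r : i + r < j + r
    i+r<j+r = +-monoˡ-< r i<j

  -- By `width`, `j` is at most one block later. If `i` starts a block and `j` does not, then `j`
  -- stays in that block, so the start `j ∸ o′` consulted by the label is `i`, and the edge makes
  -- the label 2.
  star-down : ∀ r {i j} → i < j → E i j → star r j ≤ star r i + 2
  star-down r {i} {j} i<j ij = label-down t o t′ o′ _ _ t′≤1+t λ o≡0 o′≢0 →
    let t′≤t = t′≤t o≡0 o′≢0
    in t′≤t , subst (λ x → E x j) (sym (j∸o′≡i o≡0 t′≤t)) ij
    where
    t = (i + r) / b ; t′ = (j + r) / b ; o = (i + r) % b ; o′ = (j + r) % b

    j+r≤i+r+b : j + r ≤ i + r + b
    j+r≤i+r+b = begin
      j + r        ≤⟨ +-monoˡ-≤ r (width ij) ⟩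
      i + b + r    ≡⟨ +-assoc i b r ⟩
      i + (b + r)  ≡⟨ cong (i +_) (+-comm b r) ⟩
      i + (r + b)  ≡⟨ +-assoc i r b ⟨
      i + r + b    ∎
      where open ≤-Reasoning

    t′≤1+t : t′ ≤ suc t
    t′≤1+t = subst (t′ ≤_) ([m+n]/n≡1+m/n (i + r) b) (/-monoˡ-≤ b j+r≤i+r+b)

    i+r≡tb : o ≡ 0 → i + r ≡ t * b
    i+r≡tb o≡0 = trans (m≡m%n+[m/n]*n (i + r) b) (cong (_+ t * b) o≡0)

    t′≤t : o ≡ 0 → o′ ≢ 0 → t′ ≤ t
    -- `j + r` is at most `suc t * b` but not a multiple of `b`, so its block number is below
    -- `suc t`.
    t′≤t o≡0 o′≢0 = ≤-pred (*-cancelʳ-< b t′ (suc t) (begin-strict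
      t′ * b       <⟨ m<n+m (t′ * b) (n≢0⇒n>0 o′≢0) ⟩
      o′ + t′ * b  ≡⟨ m≡m%n+[m/n]*n (j + r) b ⟨
      j + r        ≤⟨ j+r≤i+r+b ⟩
      i + r + b    ≡⟨ cong (_+ b) (i+r≡tb o≡0) ⟩
      t * b + b    ≡⟨ +-comm (t * b) b ⟩
      suc t * b    ∎))
      where open ≤-Reasoning

    j∸o′≡i : o ≡ 0 → t′ ≤ t → j ∸ o′ ≡ i
    j∸o′≡i o≡0 t′≤t = trans (cong (_∸ o′) j≡o′+i) (m+n∸m≡n o′ i)
      where
      open ≡-Reasoning
      t′≡t : t′ ≡ t
      t′≡t = ≤-antisym t′≤t (/-monoˡ-≤ b (+-monoˡ-≤ r (<⇒≤ i<j)))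
      j≡o′+i : j ≡ o′ + i
      j≡o′+i = +-cancelʳ-≡ r j (o′ + i) (begin
        j + r         ≡⟨ m≡m%n+[m/n]*n (j + r) b ⟩
        o′ + t′ * b   ≡⟨ cong (λ x → o′ + x * b) t′≡t ⟩
        o′ + t * b    ≡⟨ cong (o′ +_) (i+r≡tb o≡0) ⟨
        o′ + (i + r)  ≡⟨ +-assoc o′ i r ⟨
        o′ + i + r    ∎)

  -- Here `i` starts a block and has label 0. The other index has offset `suc e`, so its label tests
  -- adjacency to `i` and equals 3, one more than the unit.
  star-apart : ∀ r {i} e → (i + r) % b ≡ 0 → suc e < b → ¬ E i (suc e + i) →
               star r i + 2 < star r (suc e + i)
  star-apart r {i} e o≡0 e<b ¬ij = begin-strict
    star r i + 2    ≡⟨ cong (λ x → t + x + 2) (label-zero o≡0) ⟩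
    t + 0 + 2       ≡⟨ cong (_+ 2) (+-identityʳ t) ⟩
    t + 2           <⟨ +-monoʳ-< t (n<1+n 2) ⟩
    t + 3           ≤⟨ +-monoˡ-≤ 3 (/-monoˡ-≤ b (+-monoˡ-≤ r (m≤n+m i (suc e)))) ⟩
    (j + r) / b + 3 ≡⟨ cong ((j + r) / b +_) (label-non-neighbour o′≡1+e) ⟨
    star r j        ∎
    where
    open ≤-Reasoning
    j = suc e + i
    t = (i + r) / b

    label-zero : ∀ {o} {d : Dec (E (i ∸ o) i)} → o ≡ 0 → label o d ≡ 0
    label-zero refl = refl

    label-non-neighbour : ∀ {o} → o ≡ suc e → label o (E? (j ∸ o) j) ≡ 3
    label-non-neighbour refl =
      label≡3 e (E? (j ∸ suc e) j) (¬ij ∘ subst (λ x → E x j) (m+n∸m≡n e i))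

    o′≡1+e : (j + r) % b ≡ suc e
    o′≡1+e = begin-equality
      (suc e + i + r) % b    ≡⟨ cong (_% b) (+-assoc (suc e) i r) ⟩
      (suc e + (i + r)) % b  ≡⟨ cong (λ x → (suc e + x) % b) i+r≡tb ⟩
      (suc e + t * b) % b    ≡⟨ [m+kn]%n≡m%n (suc e) t b ⟩
      suc e % b              ≡⟨ m<n⇒m%n≡m e<b ⟩
      suc e                  ∎
      where
      i+r≡tb : i + r ≡ t * b
      i+r≡tb = trans (m≡m%n+[m/n]*n (i + r) b) (cong (_+ t * b) o≡0)

  -- The number of non-adjacent pairs (k , k + b) with k ≡ o (mod b) and
  -- k + b ≤ o + t * b, so that shift grows from i to i + b exactly when these
  -- are not adjacent.
  drift : ℕ → ℕ → ℕ
  drift zero    o = 0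
  drift (suc t) o = drift t o + bit (E? (o + t * b) (o + suc t * b))

  drift≤ : ∀ t o → drift t o ≤ t
  drift≤ zero    o = z≤n
  drift≤ (suc t) o = subst (drift (suc t) o ≤_) (+-comm t 1) (+-mono-≤ (drift≤ t o) (bit≤1 _))

  shift : ℕ → ℕ
  shift i = drift (i / b) (i % b)

  shift≤ : ∀ i → shift i ≤ i
  shift≤ i = ≤-trans (drift≤ (i / b) (i % b)) (m/n≤m i b)

  -- Adding `b` keeps the residue and raises the quotient by one, so `drift` unfolds by a single
  -- step.
  shift-+ : ∀ i → shift (i + b) ≡ shift i + bit (E? i (i + b))
  shift-+ i = begin
    shift (i + b)
      ≡⟨ cong₂ drift ([m+n]/n≡1+m/n i b) ([m+n]%n≡m%n i b) ⟩
    shift i + bit (E? (i % b + i / b * b) (i % b + suc (i / b) * b))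
      ≡⟨ cong₂ (λ x y → shift i + bit (E? x y)) (sym i≡) next ⟩
    shift i + bit (E? i (i + b)) ∎
    where
    open ≡-Reasoning
    i≡ : i ≡ i % b + i / b * b
    i≡ = m≡m%n+[m/n]*n i b
    next : i % b + suc (i / b) * b ≡ i + b
    next = begin
      i % b + (b + i / b * b)  ≡⟨ cong (i % b +_) (+-comm b (i / b * b)) ⟩
      i % b + (i / b * b + b)  ≡⟨ +-assoc (i % b) (i / b * b) b ⟨
      i % b + i / b * b + b    ≡⟨ cong (_+ b) i≡ ⟨
      i + b                    ∎

  module _ (N : ℕ) where

    -- The factor suc N exceeds every shift of an index up to N, so the
    -- perturbation only matters for pairs at distance exactly b.
    line : ℕ → ℕ
    line i = i * suc N + shift i

    -- The perturbation is at most `N`, too small to reach the next multiple of `suc N`.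
    line< : ∀ {i} → i ≤ N → line i < suc i * suc N
    line< {i} i≤N = begin-strict
      i * suc N + shift i  ≤⟨ +-monoʳ-≤ (i * suc N) (≤-trans (shift≤ i) i≤N) ⟩
      i * suc N + N        <⟨ +-monoʳ-< (i * suc N) (n<1+n N) ⟩
      i * suc N + suc N    ≡⟨ +-comm (i * suc N) (suc N) ⟩
      suc i * suc N        ∎
      where open ≤-Reasoning

    line-mono-< : ∀ {i j} → i ≤ N → i < j → line i < line j
    line-mono-< {i} {j} i≤N i<j = begin-strict
      line i         <⟨ line< i≤N ⟩
      suc i * suc N  ≤⟨ *-monoˡ-≤ (suc N) i<j ⟩
      j * suc N      ≤⟨ m≤m+n _ (shift j) ⟩
      line j         ∎
      where open ≤-Reasoning

    line-+ : ∀ i → line (i + b) ≡ line i + b * suc N + bit (E? i (i + b))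
    line-+ i = begin
      (i + b) * M + shift (i + b)  ≡⟨ cong₂ _+_ (*-distribʳ-+ M i b) (shift-+ i) ⟩
      i * M + b * M + (shift i + β)  ≡⟨ +-assoc (i * M + b * M) (shift i) β ⟨
      i * M + b * M + shift i + β  ≡⟨ cong (_+ β) (+-assoc (i * M) (b * M) (shift i)) ⟩
      i * M + (b * M + shift i) + β  ≡⟨ cong (λ x → i * M + x + β) (+-comm (b * M) (shift i)) ⟩
      i * M + (shift i + b * M) + β  ≡⟨ cong (_+ β) (+-assoc (i * M) (shift i) (b * M)) ⟨
      line i + b * M + β  ∎
      where
      open ≡-Reasoning
      M = suc N
      β = bit (E? i (i + b))

    -- At distance exactly `b` the edge makes `bit` vanish and equality holds; at a smaller distance
    -- a whole spare multiple of `suc N` absorbs the perturbation.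
    line-down : ∀ {i j} → j ≤ N → E i j → line j ≤ line i + b * suc N
    line-down {i} {j} j≤N ij with m≤n⇒m<n∨m≡n (width ij)
    ... | inj₂ refl = ≤-reflexive (trans (line-+ i)
            (trans (cong (line i + b * suc N +_) (bit≡0 (E? i (i + b)) ij))
                   (+-identityʳ (line i + b * suc N))))
    ... | inj₁ j<i+b = begin
      line j                         ≤⟨ <⇒≤ (line< j≤N) ⟩
      suc j * suc N                  ≤⟨ *-monoˡ-≤ (suc N) j<i+b ⟩
      (i + b) * suc N                ≡⟨ *-distribʳ-+ (suc N) i b ⟩
      i * suc N + b * suc N          ≤⟨ +-monoˡ-≤ (b * suc N) (m≤m+n _ (shift i)) ⟩
      line i + b * suc N             ∎
      where open ≤-Reasoning

    -- At distance exactly `b` the missing edge supplies the decisive extra 1; farther away, strict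
    -- monotonicity does.
    line-apart : ∀ {i j} → j ≤ N → i + b ≤ j → ¬ E i j → line i + b * suc N < line j
    line-apart {i} {j} j≤N i+b≤j ¬ij with m≤n⇒m<n∨m≡n i+b≤j
    ... | inj₂ refl = subst (line i + b * suc N <_) (sym (line-+ i))
            (subst (λ x → line i + b * suc N < line i + b * suc N + x)
                   (sym (bit≡1 (E? i (i + b)) ¬ij)) (m<m+n (line i + b * suc N) z<s))
    ... | inj₁ i+b<j = begin-strict
      line i + b * suc N                           ≤⟨ m≤m+n _ _ ⟩
      line i + b * suc N + bit (E? i (i + b))      ≡⟨ line-+ i ⟨
      line (i + b)                                 <⟨ line-mono-< (≤-trans i+b≤j j≤N) i+b<j ⟩
      line j                                       ∎
      where open ≤-Reasoning

-- Cube representations from vertex orderings.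

bandwidth⇒cubeRepresentation :
  ∀ {n} (G : Graph n) (σ : Fin n → ℕ) b′ →
  (∀ {u v} → σ u ≡ σ v → u ≡ v) →
  (∀ v → σ v ≤ n) →
  (∀ {u v} → Adj G u v → σ v ≤ σ u + suc b′) →
  CubeRepresentation G (suc (suc b′))
bandwidth⇒cubeRepresentation {n} G σ b′ σ-injective σ≤n width =
  cubeRepresentation G (suc b) pred-unit position close apart
  where
  b = suc b′

  -- An existential form, so that positions not attained by `σ` carry no edges and the coordinates
  -- can be defined on all of ℕ.
  E : Rel ℕ 0ℓ
  E i j = ∃[ u ] ∃[ v ] (σ u ≡ i × σ v ≡ j × Adj G u v)

  E? : Decidable E
  E? i j = any? λ u → any? λ v → (σ u ≟ i) ×-dec ((σ v ≟ j) ×-dec adj? G u v)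

  edge : ∀ {u v} → Adj G u v → E (σ u) (σ v)
  edge uv = _ , _ , refl , refl , uv

  edge⁻¹ : ∀ {u v} → E (σ u) (σ v) → Adj G u v
  edge⁻¹ (u , v , σu≡ , σv≡ , uv) = subst₂ (Adj G) (σ-injective σu≡) (σ-injective σv≡) uv

  E-width : ∀ {i j} → E i j → j ≤ i + b
  E-width (u , v , refl , refl , uv) = width uv

  open Bandwidth E? b E-width

  -- The units are b * suc n for line and 2 for star.
  pred-unit : Fin (suc b) → ℕ
  pred-unit zero    = n + b′ * suc n
  pred-unit (suc _) = 1

  position : Fin (suc b) → Fin n → ℕ
  position zero    v = line n (σ v)
  position (suc r) v = star (toℕ r) (σ v)

  close : ∀ {u v} → Adj G u v → ∀ k → position k u ≤ position k v + suc (pred-unit k)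
  close {u} {v} uv k with <-cmp (σ u) (σ v)
  ... | tri≈ _ σu≡σv _ = contradiction uv (irrefl G (σ-injective σu≡σv))
  close {u} {v} uv zero | tri< σu<σv _ _ =
    ≤-trans (<⇒≤ (line-mono-< n (σ≤n u) σu<σv)) (m≤m+n _ (b * suc n))
  close {u} {v} uv (suc r) | tri< σu<σv _ _ = star-up (toℕ r) σu<σv
  close {u} {v} uv zero | tri> _ _ σv<σu = line-down n (σ≤n u) (edge (symm G uv))
  close {u} {v} uv (suc r) | tri> _ _ σv<σu = star-down (toℕ r) σv<σu (edge (symm G uv))

  apart< : ∀ {u v} → σ u < σ v → ¬ Adj G u v →
           ∃[ k ] (position k u + suc (pred-unit k) < position k v)
  apart< {u} {v} σu<σv ¬uv with σ u + b ≤? σ v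
  ... | yes far = zero , line-apart n (σ≤n v) far (¬uv ∘ edge⁻¹)
  ... | no near with m≤n⇒∃[o]m+o≡n σu<σv
  -- The distance is `suc e`, and the chosen coordinate is the residue of `-σ u`, for which `σ u`
  -- starts a block.
  ...   | e , 1+σu+e≡σv = suc (fromℕ< r<b) , subst₂ (λ r j → star r (σ u) + 2 < star r j)
            (sym (toℕ-fromℕ< r<b)) 1+e+σu≡σv
            (star-apart _ e (complementary-residue (σ u) b′) 1+e<b
              (¬uv ∘ edge⁻¹ ∘ subst (E (σ u)) 1+e+σu≡σv))
    where
    r<b : (b′ * σ u) % b < b
    r<b = m%n<n (b′ * σ u) b
    1+e+σu≡σv : suc e + σ u ≡ σ v
    1+e+σu≡σv = trans (cong suc (+-comm e (σ u))) 1+σu+e≡σv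
    1+e<b : suc e < b
    1+e<b = +-cancelʳ-< (σ u) (suc e) b
      (subst₂ _<_ (sym 1+e+σu≡σv) (+-comm (σ u) b) (≰⇒> near))

  apart : ∀ {u v} → u ≢ v → ¬ Adj G u v →
          ∃[ k ] (position k u + suc (pred-unit k) < position k v ⊎
                  position k v + suc (pred-unit k) < position k u)
  apart {u} {v} u≢v ¬uv with <-cmp (σ u) (σ v)
  ... | tri< σu<σv _ _ = let (k , gap) = apart< σu<σv ¬uv in k , inj₁ gap
  ... | tri≈ _ σu≡σv _ = contradiction (σ-injective σu≡σv) u≢v
  ... | tri> _ _ σv<σu = let (k , gap) = apart< σv<σu (¬uv ∘ symm G) in k , inj₂ gap

-- Counting by filtered lists.

module _ {A : Set} {P Q R : A → Set}
  (P? : Unary.Decidable P) (Q? : Unary.Decidable Q) (R? : Unary.Decidable R)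
  where

  length-filter-∪ : (∀ {x} → P x → Q x ⊎ R x) → ∀ xs →
    length (filter P? xs) ≤ length (filter Q? xs) + length (filter R? xs)
  length-filter-∪ P⊆ [] = z≤n
  length-filter-∪ P⊆ (x ∷ xs) with P? x | Q? x | R? x | length-filter-∪ P⊆ xs
  ... | no _  | no _  | no _  | ih = ih
  ... | no _  | no _  | yes _ | ih = ≤-trans ih (+-monoʳ-≤ _ (n≤1+n _))
  ... | no _  | yes _ | no _  | ih = m≤n⇒m≤1+n ih
  ... | no _  | yes _ | yes _ | ih = m≤n⇒m≤1+n (≤-trans ih (+-monoʳ-≤ _ (n≤1+n _)))
  ... | yes _ | yes _ | no _  | ih = s≤s ih
  ... | yes _ | yes _ | yes _ | ih = s≤s (≤-trans ih (+-monoʳ-≤ _ (n≤1+n _)))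
  ... | yes _ | no _  | yes _ | ih = ≤-trans (s≤s ih) (≤-reflexive (sym (+-suc _ _)))
  ... | yes p | no ¬q | no ¬r | ih with P⊆ p
  ...   | inj₁ q = contradiction q ¬q
  ...   | inj₂ r = contradiction r ¬r

module _ {A : Set} {P Q : A → Set} (P? : Unary.Decidable P) (Q? : Unary.Decidable Q)
  (P⊆Q : ∀ {x} → P x → Q x)
  where

  length-filter-⊆ : ∀ xs → length (filter P? xs) ≤ length (filter Q? xs)
  length-filter-⊆ [] = z≤n
  length-filter-⊆ (x ∷ xs) with P? x | Q? x | length-filter-⊆ xs
  ... | no _  | no _  | ih = ih
  ... | no _  | yes _ | ih = m≤n⇒m≤1+n ih
  ... | yes _ | yes _ | ih = s≤s ih
  ... | yes p | no ¬q | _  = contradiction (P⊆Q p) ¬q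

  length-filter-⊂ : ∀ {y xs} → y ∈ xs → Q y → ¬ P y →
    length (filter P? xs) < length (filter Q? xs)
  length-filter-⊂ {y} {x ∷ xs} (here refl) qy ¬py with P? x | Q? x
  ... | yes p | _     = contradiction p ¬py
  ... | no _  | no ¬q = contradiction qy ¬q
  ... | no _  | yes _ = s≤s (length-filter-⊆ xs)
  length-filter-⊂ {y} {x ∷ xs} (there y∈xs) qy ¬py
    with P? x | Q? x | length-filter-⊂ y∈xs qy ¬py
  ... | no _  | no _  | ih = ih
  ... | no _  | yes _ | ih = m≤n⇒m≤1+n ih
  ... | yes _ | yes _ | ih = s≤s ih
  ... | yes p | no ¬q | _  = contradiction (P⊆Q p) ¬q

count : ∀ {n} {P : Fin n → Set} → Unary.Decidable P → ℕ
count {n} P? = length (filter P? (allFin n))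

-- A linear extension and its ranks.

module LinearExtension {n} {_≺_ : Rel (Fin n) 0ℓ}
  (≺-isStrictPartialOrder : IsStrictPartialOrder _≡_ _≺_) (_≺?_ : Decidable _≺_)
  where

  open IsStrictPartialOrder ≺-isStrictPartialOrder
    using () renaming (irrefl to ≺-irrefl; trans to ≺-trans)

  height : Fin n → ℕ
  height v = count (_≺? v)

  -- By transitivity everything below `u` is below `v`, and `u` itself is counted only for `v`.
  height-mono-< : ∀ {u v} → u ≺ v → height u < height v
  height-mono-< {u} {v} u≺v =
    length-filter-⊂ (_≺? u) (_≺? v) (λ w≺u → ≺-trans w≺u u≺v) (∈-allFin u) u≺v (≺-irrefl refl)

  -- Lexicographic order on (height , toℕ).
  key : Fin n → ℕ
  key v = height v * n + toℕ v

  height<⇒key< : ∀ {u v} → height u < height v → key u < key v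
  height<⇒key< {u} {v} hu<hv = begin-strict
    height u * n + toℕ u  <⟨ +-monoʳ-< (height u * n) (toℕ<n u) ⟩
    height u * n + n      ≡⟨ +-comm _ n ⟩
    suc (height u) * n    ≤⟨ *-monoˡ-≤ n hu<hv ⟩
    height v * n          ≤⟨ m≤m+n _ (toℕ v) ⟩
    key v                 ∎
    where open ≤-Reasoning

  key-injective : ∀ {u v} → key u ≡ key v → u ≡ v
  key-injective {u} {v} ku≡kv with <-cmp (height u) (height v)
  ... | tri< hu<hv _ _ = contradiction ku≡kv (<⇒≢ (height<⇒key< hu<hv))
  ... | tri> _ _ hv<hu = contradiction (sym ku≡kv) (<⇒≢ (height<⇒key< hv<hu))
  ... | tri≈ _ hu≡hv _ = toℕ-injective (+-cancelˡ-≡ (height v * n) _ _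
          (subst (λ h → h * n + toℕ u ≡ key v) hu≡hv ku≡kv))

  -- Keys may leave gaps; ranks do not, so a difference of ranks counts vertices and can be compared
  -- with degrees.
  rank : Fin n → ℕ
  rank v = count λ w → key w <? key v

  rank-mono-< : ∀ {u v} → key u < key v → rank u < rank v
  rank-mono-< {u} {v} ku<kv = length-filter-⊂ (λ w → key w <? key u) (λ w → key w <? key v)
    (λ kw<ku → <-trans kw<ku ku<kv) (∈-allFin u) ku<kv (<-irrefl refl)

  rank-injective : ∀ {u v} → rank u ≡ rank v → u ≡ v
  rank-injective {u} {v} ru≡rv with <-cmp (key u) (key v)
  ... | tri< ku<kv _ _ = contradiction ru≡rv (<⇒≢ (rank-mono-< ku<kv))
  ... | tri≈ _ ku≡kv _ = key-injective ku≡kv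
  ... | tri> _ _ kv<ku = contradiction (sym ru≡rv) (<⇒≢ (rank-mono-< kv<ku))

  rank≤n : ∀ v → rank v ≤ n
  rank≤n v = subst (rank v ≤_) (length-tabulate {n = n} (λ i → i)) (length-filter _ (allFin n))

-- Width of the ordering of a co-comparability graph.

degree≤maxDegree : ∀ {n} (G : Graph n) v → degree G v ≤ maxDegree G
degree≤maxDegree {n} G v =
  All.lookup (All.map⁻ (xs≤max 0 (map (degree G) (allFin n)))) (∈-allFin v)

-- Adjacency in `H` decides comparability, and asymmetry then settles the direction.
≺-decidable : ∀ {n} {_≺_ : Rel (Fin n) 0ℓ} (H : Graph n) → IsStrictPartialOrder _≡_ _≺_ →
  (∀ u v → u ≢ v → Adj H u v ⇔ (u ≺ v ⊎ v ≺ u)) → Decidable _≺_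
≺-decidable H isSPO comparable u v with u Fin.≟ v
... | yes refl = no (IsStrictPartialOrder.irrefl isSPO refl)
... | no u≢v with adj? H u v
...   | no ¬uv = no (¬uv ∘ Equivalence.from (comparable u v u≢v) ∘ inj₁)
...   | yes uv with Equivalence.to (comparable u v u≢v) uv
...     | inj₁ u≺v = yes u≺v
...     | inj₂ v≺u = no λ u≺v → IsStrictPartialOrder.asym isSPO u≺v v≺u

module _ {n} (G : Graph n) {_≺_ : Rel (Fin n) 0ℓ}
  (isSPO : IsStrictPartialOrder _≡_ _≺_)
  (comparable : ∀ u v → u ≢ v → Adj (complement G) u v ⇔ (u ≺ v ⊎ v ≺ u))
  where

  open LinearExtension isSPO (≺-decidable (complement G) isSPO comparable)

  -- Non-adjacent distinct vertices are comparable, and `v ≺ u` would reverse the keys, since keys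
  -- extend `≺`.
  key<⇒≺ : ∀ {u v} → key u < key v → ¬ Adj G u v → u ≺ v
  key<⇒≺ {u} {v} ku<kv ¬uv with Equivalence.to (comparable u v u≢v) (u≢v , ¬uv)
    where
    u≢v : u ≢ v
    u≢v refl = <-irrefl refl ku<kv
  ... | inj₁ u≺v = u≺v
  ... | inj₂ v≺u = contradiction (height<⇒key< (height-mono-< v≺u)) (<-asym ku<kv)

  ≺⇒¬Adj : ∀ {u v} → u ≺ v → ¬ Adj G u v
  ≺⇒¬Adj {u} {v} u≺v = proj₂ (Equivalence.from (comparable u v u≢v) (inj₁ u≺v))
    where
    u≢v : u ≢ v
    u≢v u≡v = IsStrictPartialOrder.irrefl isSPO u≡v u≺v

  -- A vertex strictly between and adjacent to neither end would give `u ≺ w ≺ v`, against the edge.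
  -- The ends are covered by the edge itself, each being a neighbour of the other.
  interval⊆neighbours : ∀ {u v} → key u < key v → Adj G u v → ∀ {w} → key w ≤ key v →
    key w < key u ⊎ (Adj G u w ⊎ Adj G v w)
  interval⊆neighbours {u} {v} ku<kv uv {w} kw≤kv
    with <-cmp (key w) (key u) | m≤n⇒m<n∨m≡n kw≤kv | adj? G u w | adj? G v w
  ... | tri< kw<ku _ _ | _ | _ | _ = inj₁ kw<ku
  ... | _ | _ | yes uw | _ = inj₂ (inj₁ uw)
  ... | _ | _ | _ | yes vw = inj₂ (inj₂ vw)
  ... | tri≈ _ kw≡ku _ | _ | _ | _ =
    inj₂ (inj₂ (subst (Adj G v) (sym (key-injective kw≡ku)) (symm G uv)))
  ... | _ | inj₂ kw≡kv | _ | _ = inj₂ (inj₁ (subst (Adj G u) (sym (key-injective kw≡kv)) uv))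
  ... | tri> _ _ ku<kw | inj₁ kw<kv | no ¬uw | no ¬vw = contradiction uv (≺⇒¬Adj
    (IsStrictPartialOrder.trans isSPO (key<⇒≺ ku<kw ¬uw) (key<⇒≺ kw<kv (¬vw ∘ symm G))))

  -- The vertices up to and including `v` either precede `u`, which accounts for `rank u` of them,
  -- or are neighbours of `u` or `v`. Counting `v` itself makes the bound strict and saves one
  -- dimension.
  rank-width : ∀ {u v} → Adj G u v → rank v < rank u + 2 * maxDegree G
  rank-width {u} {v} uv with <-cmp (key u) (key v)
  ... | tri≈ _ ku≡kv _ = contradiction uv (irrefl G (key-injective ku≡kv))
  ... | tri> _ _ kv<ku = <-≤-trans (rank-mono-< kv<ku) (m≤m+n (rank u) _)
  ... | tri< ku<kv _ _ = begin-strict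
    rank v
      <⟨ length-filter-⊂ (λ w → key w <? key v) (λ w → key w ≤? key v) <⇒≤
           (∈-allFin v) ≤-refl (<-irrefl refl) ⟩
    count (λ w → key w ≤? key v)
      ≤⟨ length-filter-∪ (λ w → key w ≤? key v) (λ w → key w <? key u)
           (λ w → adj? G u w ⊎-dec adj? G v w) (interval⊆neighbours ku<kv uv) (allFin n) ⟩
    rank u + count (λ w → adj? G u w ⊎-dec adj? G v w)
      ≤⟨ +-monoʳ-≤ (rank u) (length-filter-∪ _ (adj? G u) (adj? G v) (λ x → x) (allFin n)) ⟩
    rank u + (degree G u + degree G v)
      -- `2 * m` unfolds to `m + (m + 0)`, whence the zero added to the second bound.
      ≤⟨ +-monoʳ-≤ (rank u) (+-mono-≤ (degree≤maxDegree G u)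
           (≤-trans (degree≤maxDegree G v) (m≤m+n _ 0))) ⟩
    rank u + 2 * maxDegree G ∎
    where open ≤-Reasoning

  -- The parameter `b′` is `d + (d + 0)`, that is, 2Δ - 2; hence the width is 2Δ - 1 and the
  -- dimension 2Δ.
  coComparability⇒cubeRepresentation : ∀ d → maxDegree G ≡ suc d → CubeRepresentation G (2 * suc d)
  coComparability⇒cubeRepresentation d Δ≡1+d =
    subst (CubeRepresentation G) (cong suc (sym (+-suc d (d + 0))))
      (bandwidth⇒cubeRepresentation G rank (d + (d + 0)) rank-injective rank≤n λ {u} {v} uv →
        ≤-pred (subst (rank v <_) (rank+2Δ u) (rank-width uv)))
    where
    rank+2Δ : ∀ u → rank u + 2 * maxDegree G ≡ suc (rank u + suc (d + (d + 0)))
    rank+2Δ u = trans (cong (λ x → rank u + 2 * x) Δ≡1+d)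
      (trans (+-suc (rank u) _) (cong (λ x → suc (rank u + x)) (+-suc d (d + 0))))

corollary2 : ∀ (n : ℕ) (G : Graph n) →
    IsCoComparability G →
    (2 ≤ n → 1 ≤ maxDegree G) →
    Cubicity≤ G (2 * maxDegree G)
corollary2 n G (_ , isSPO , comparable) 2≤n⇒1≤Δ =
    (_ , ≤-refl , representation)
  , λ c (_ , minimal) → minimal _ representation
  where
  representation : CubeRepresentation G (2 * maxDegree G)
  representation with maxDegree G in Δ≡
  ... | suc d = coComparability⇒cubeRepresentation G isSPO comparable d Δ≡
  -- In dimension 0 all cubes meet, so no non-adjacent pair can be separated; but two distinct
  -- vertices would force a positive maximum degree, so there is no pair to treat.
  ... | zero  = (λ _ ()) , λ u v u≢v →
    contradiction (2≤n⇒1≤Δ (two u v u≢v)) λ ()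
    where
    two : ∀ {m} (u v : Fin m) → u ≢ v → 2 ≤ m
    two {suc zero}    zero zero u≢v = contradiction refl u≢v
    two {suc (suc m)} _    _    _   = s≤s (s≤s z≤n)
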